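{- Let $n\ge1$. The map sending a torsion class $\mathcal G$ of size $n$ to its Young diagram with gaps $Y(\mathcal G)$, and then to the Young diagram obtained from $Y(\mathcal G)$ by removing the gaps, is a bijection from the set of torsion classes of size $n$ onto the set of Young diagrams that are subdiagrams of the full Young diagram $(n,n-1,\dots,2,1)$ of size $n$.
   Context: Torsion classes of size $n$. The objects are $\tfrac{n(n+1)}2$ balls arranged in a triangle with $1$ ball in the top row, $2$ in the second row, ..., $n$ in the bottom row. Index the balls by pairs $[i,j]$ with $1\le i\le j\le n$, with $[i,j]$ drawn at the point $\left(\tfrac{i+j}2,\tfrac{j-i}2\right)$. (They represent the indecomposable representations of the linearly oriented quiver $A_n$.) $\mathrm{Hom}(X,Y)\neq0$ iff the entire rectangle with left corner $X$ and right corner $Y$ lies in the triangle; explicitly, $\mathrm{Hom}([i,j],[i',j'])\ne0$ iff $i\le i'\le j\le j'$. A pair $(\mathcal G,\mathcal F)$ of subsets of balls is a torsion pair if $\mathcal G=\{X:\mathrm{Hom}(X,Y)=0\ \forall\,Y\in\mathcal F\}$ and $\mathcal F=\{Y:\mathrm{Hom}(X,Y)=0\ \forall\,X\in\mathcal G\}$; a torsion class is the set $\mathcal G$ of some torsion pair. Columns. For $1\le i\le n$, column $i$ is the ascending line of balls $[i,i],[i,i+1],\dots,[i,n]$, from lowest to highest. Young diagram with gaps of a torsion class. For each column $i$ that contains an element of $\mathcal G$, let $[i,j]$ be the lowest ball of column $i$ in $\mathcal G$, and put boxes on $[i,j]$ and on all balls $[i,j']$, $j'\ge j$, above it in the same column.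 If column $i$ has no element of $\mathcal G$, put no boxes in it. The resulting set of boxes is $Y(\mathcal G)$. Removing gaps. Sort the columns of $Y(\mathcal G)$ by number of boxes in weakly decreasing order from left to right and align them at the top with no gaps; this gives a Young diagram whose column lengths are the sorted numbers of boxes. A Young diagram is a weakly decreasing sequence $\lambda_1\ge\lambda_2\ge\cdots\ge0$ of row lengths (the empty diagram allowed); it is a subdiagram of $(n,n-1,\dots,1)$ if $\lambda_i\le n+1-i$ for $1\le i\le n$ and $\lambda_i=0$ for $i>n$. -}

module Defs where

open import Data.Fin.Base as Fin using (Fin)
import Data.Fin.Properties as Fin
open import Data.List.Base using (List; allFin; filter; length; map; mapMaybe)
import Data.List.Relation.Binary.Sublist.Propositional as Sublist
import Data.List.Relation.Binary.Sublist.Propositional.Properties as Sublist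
import Data.List.Sort
import Data.Maybe.Base as Maybe
open import Data.Nat.Base using (ℕ; suc; _∸_; _≤_; _<_; _≥_)
open import Data.Nat.Properties using (_<?_; <-trans; n<1+n; ≤-decTotalOrder)
open import Data.Product.Base using (∃; Σ; _×_; _,_; proj₁)
open import Function.Base using (_on_)
open import Level using (0ℓ)
open import Relation.Binary.Core using (Rel)
import Relation.Binary.Construct.Flip.EqAndOrd as Flip
open import Relation.Binary.PropositionalEquality using (_≡_; _≗_; refl)
open import Relation.Nullary using (¬_; Dec; yes; no; contradiction; recompute)
open import Relation.Nullary.Decidable using (map′; _×-dec_; _→-dec_; dec⇒maybe)
open import Relation.Unary using (Pred; Decidable; _≐_)

-- Ball [i , j] with 1 ≤ i ≤ j ≤ n is represented with both indices shifted
-- down by one; Hom and the columns are unaffected by this translation.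
record Ball (n : ℕ) : Set where
  constructor [_,_]⟨_⟩
  field
    left       : Fin n
    right      : Fin n
    .left≤right : left Fin.≤ right

open Ball public

private
  variable
    n : ℕ

Hom≠0 : Rel (Ball n) 0ℓ
Hom≠0 X Y = left X Fin.≤ left Y × left Y Fin.≤ right X × right X Fin.≤ right Y

-- Subsets of the finite set of balls carry a decision procedure, so that
-- their elements can be counted.
record BallSet (n : ℕ) : Set₁ where
  field
    Member  : Pred (Ball n) 0ℓ
    member? : Decidable Member

open BallSet public

infix 4 _∈_

_∈_ : Ball n → BallSet n → Set
X ∈ S = Member S X

record IsTorsionPair (G F : BallSet n) : Set where
  field
    G≐⊥F : Member G ≐ λ X → ∀ Y → Y ∈ F → ¬ Hom≠0 X Y
    F≐G⊥ : Member F ≐ λ Y → ∀ X → X ∈ G → ¬ Hom≠0 X Y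

record TorsionClass (n : ℕ) : Set₁ where
  field
    ballSet       : BallSet n
    isTorsionPair : ∃ λ F → IsTorsionPair ballSet F

open TorsionClass public

infix 4 _≈ₜ_

_≈ₜ_ : Rel (TorsionClass n) 0ℓ
_≈ₜ_ = _≐_ on λ G → Member (ballSet G)

-- All [ i , j ] with j ≥ i, from lowest to highest.
column : Fin n → List (Ball n)
column {n} i = mapMaybe
  (λ j → Maybe.map (λ i≤j → [ i , j ]⟨ i≤j ⟩) (dec⇒maybe (i Fin.≤? j)))
  (allFin n)

any-ball? : {P : Pred (Ball n) 0ℓ} → Decidable P → Dec (∃ P)
any-ball? {P = P} P? = map′
  (λ (i , j , i≤j , p) → [ i , j ]⟨ i≤j ⟩ , p)
  (λ { ([ i , j ]⟨ i≤j ⟩ , p) → i , j , recompute (i Fin.≤? j) i≤j , p })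
  (Fin.any? λ i → Fin.any? λ j → dec-Σ i j)
  where
  dec-Σ : ∀ i j → Dec (Σ (i Fin.≤ j) λ i≤j → P [ i , j ]⟨ i≤j ⟩)
  dec-Σ i j with i Fin.≤? j
  ... | no  i≰j = no λ (i≤j , _) → i≰j i≤j
  ... | yes i≤j = map′ (i≤j ,_) (λ (_ , p) → p) (P? [ i , j ]⟨ i≤j ⟩)

all-balls? : {P : Pred (Ball n) 0ℓ} → Decidable P → Dec (∀ X → P X)
all-balls? {P = P} P? = map′
  (λ { all [ i , j ]⟨ i≤j ⟩ → all i j (recompute (i Fin.≤? j) i≤j) })
  (λ all i j i≤j → all [ i , j ]⟨ i≤j ⟩)
  (Fin.all? λ i → Fin.all? λ j → dec-Π i j)
  where
  dec-Π : ∀ i j → Dec ((i≤j : i Fin.≤ j) → P [ i , j ]⟨ i≤j ⟩)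
  dec-Π i j with i Fin.≤? j
  ... | no  i≰j = yes λ i≤j → contradiction i≤j i≰j
  ... | yes i≤j = map′ (λ p _ → p) (λ all → all i≤j) (P? [ i , j ]⟨ i≤j ⟩)

LowestInColumn : BallSet n → Pred (Ball n) 0ℓ
LowestInColumn G X =
  X ∈ G × (∀ Z → left Z ≡ left X → Z ∈ G → right X Fin.≤ right Z)

lowestInColumn? : (G : BallSet n) → Decidable (LowestInColumn G)
lowestInColumn? G X = member? G X ×-dec
  all-balls? λ Z → (left Z Fin.≟ left X) →-dec
                   (member? G Z →-dec (right X Fin.≤? right Z))

-- A ball carries a box iff it is weakly above the lowest ball of G in its
-- own column.
Y : TorsionClass n → BallSet n
Y G = record
  { Member  = λ X → ∃ λ L → LowestInColumn (ballSet G) L ×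
                            left L ≡ left X × right L Fin.≤ right X
  ; member? = λ X → any-ball? λ L → lowestInColumn? (ballSet G) L ×-dec
                            (left L Fin.≟ left X ×-dec right L Fin.≤? right X)
  }

-- The sequence is indexed from 0: row k is the part usually written λₖ₊₁.
record YoungDiagram : Set where
  field
    row        : ℕ → ℕ
    decreasing : ∀ k → row (suc k) ≤ row k

open YoungDiagram public

infix 4 _≈ᵧ_

_≈ᵧ_ : Rel YoungDiagram 0ℓ
_≈ᵧ_ = _≗_ on row

-- With the shifted row index, the bound n + 1 - i on λᵢ becomes n - k.
record IsSubdiagram (n : ℕ) (D : YoungDiagram) : Set where
  field
    row≤  : ∀ k → k < n → row D k ≤ n ∸ k
    row≡0 : ∀ k → k ≥ n → row D k ≡ 0

Subdiagram : ℕ → Set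
Subdiagram n = ∃ (IsSubdiagram n)

infix 4 _≈ₛ_

_≈ₛ_ : Rel (Subdiagram n) 0ℓ
_≈ₛ_ = _≈ᵧ_ on proj₁

-- The diagram whose top-aligned columns have the given lengths: its row k
-- has one box for every column with more than k boxes. This does not depend
-- on the order of the list; for a weakly decreasing list these boxes are
-- left-justified.
fromColumns : List ℕ → YoungDiagram
fromColumns ls = record
  { row        = λ k → length (filter (k <?_) ls)
  ; decreasing = λ k → Sublist.length-mono-≤
      (Sublist.filter⁺ (suc k <?_) (k <?_) (λ { refl → <-trans (n<1+n k) })
        (Sublist.⊆-refl {x = ls}))
  }

module SortDecreasing = Data.List.Sort (Flip.decTotalOrder ≤-decTotalOrder)

columnLength : BallSet n → Fin n → ℕ
columnLength S i = length (filter (member? S) (column i))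

removeGaps : BallSet n → YoungDiagram
removeGaps {n} S =
  fromColumns (SortDecreasing.sort (map (columnLength S) (allFin n)))

{-# OPTIONS --safe #-}

-- A torsion class G is determined by the heights c i of the lowest balls of
-- its columns (c i = n for an empty column), because [ i , j ] with c i < j
-- lies in G iff its quotient [ c i + 1 , j ] does. The sequences c that occur
-- are the bracketings: i ≤ c i ≤ n, and i ≤ a ≤ c i implies c a ≤ c i.
-- Read c i as the position where a bracket opened at i closes, and let
-- u v = #{ i < v | v ≤ c i } count the brackets still open at v. Then
-- c i < v iff u w ≤ u i for some i < w ≤ v, so u determines c, and every u
-- with u v ≤ v and u (v + 1) ≤ u v + 1 occurs. Finally row k of the diagram
-- of G is #{ i | c i < n - k } = (n - k) - u (n - k).
module Submission where

open import Defs
open import Data.Fin.Base as Fin using (Fin; toℕ; fromℕ<)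
import Data.Fin.Properties as Fin
open import Data.List.Base using ([]; _∷_; allFin; filter; length; map; mapMaybe; tabulate)
open import Data.List.Properties using (map-tabulate)
open import Data.List.Relation.Binary.Permutation.Propositional.Properties using (↭-length; filter-↭)
open import Data.Maybe.Base as Maybe using (Maybe; just; nothing)
open import Data.Nat.Base
open import Data.Nat.Properties
open import Data.Product.Base using (∃; Σ-syntax; _×_; _,_; proj₁; proj₂)
open import Data.Sum.Base using (_⊎_; inj₁; inj₂)
open import Function.Base using (_∘_)
open import Function.Bundles using (_⇔_; mk⇔; Equivalence)
open import Function.Structures using (IsBijection)
open import Level using (0ℓ)
import Relation.Binary.Construct.On as On
open import Relation.Binary.PropositionalEquality
open import Relation.Nullary using (¬_; Dec; yes; no; ¬?; contradiction; recompute)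
open import Relation.Nullary.Decidable using (_×-dec_; _→-dec_; dec⇒maybe)
open import Relation.Unary using (Pred; Decidable)
open import Relation.Unary.Relation.Binary.Equality using (≐-isEquivalence)

open Equivalence using (to; from)

private
  variable
    n : ℕ
    A B : Set
    P Q : Pred ℕ 0ℓ

-- Counting

indicator : Dec A → ℕ
indicator (yes _) = 1
indicator (no  _) = 0

indicator-yes : (a? : Dec A) → A → indicator a? ≡ 1
indicator-yes (yes _) a = refl
indicator-yes (no ¬a) a = contradiction a ¬a

indicator-no : (a? : Dec A) → ¬ A → indicator a? ≡ 0
indicator-no (yes a) ¬a = contradiction a ¬a
indicator-no (no _)  ¬a = refl

indicator-mono : (a? : Dec A) (b? : Dec B) → (A → B) → indicator a? ≤ indicator b?
indicator-mono (yes a) b? f = ≤-reflexive (sym (indicator-yes b? (f a)))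
indicator-mono (no _)  b? f = z≤n

indicator-cong : (a? : Dec A) (b? : Dec B) → A ⇔ B → indicator a? ≡ indicator b?
indicator-cong a? b? A⇔B =
  ≤-antisym (indicator-mono a? b? (to A⇔B)) (indicator-mono b? a? (from A⇔B))

indicator-¬ : (a? : Dec A) → indicator a? + indicator (¬? a?) ≡ 1
indicator-¬ (yes _) = refl
indicator-¬ (no  _) = refl

count : Decidable P → ℕ → ℕ
count P? zero    = 0
count P? (suc v) = indicator (P? v) + count P? v

count-mono : (P? : Decidable P) (Q? : Decidable Q) → ∀ v →
  (∀ i → i < v → P i → Q i) → count P? v ≤ count Q? v
count-mono P? Q? zero    P⊆Q = z≤n
count-mono P? Q? (suc v) P⊆Q =
  +-mono-≤ (indicator-mono (P? v) (Q? v) (P⊆Q v ≤-refl))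
           (count-mono P? Q? v λ i i<v → P⊆Q i (m<n⇒m<1+n i<v))

count-cong : (P? : Decidable P) (Q? : Decidable Q) → ∀ v →
  (∀ i → i < v → P i ⇔ Q i) → count P? v ≡ count Q? v
count-cong P? Q? v P⇔Q =
  ≤-antisym (count-mono P? Q? v λ i i<v → to (P⇔Q i i<v))
            (count-mono Q? P? v λ i i<v → from (P⇔Q i i<v))

count-monoʳ : (P? : Decidable P) → ∀ {v w} → v ≤ w → count P? v ≤ count P? w
count-monoʳ P? {v} {zero}  z≤n = z≤n
count-monoʳ P? {v} {suc w} v≤1+w with m≤n⇒m<n∨m≡n v≤1+w
... | inj₁ v<1+w = ≤-trans (count-monoʳ P? (s≤s⁻¹ v<1+w)) (m≤n+m _ (indicator (P? w)))
... | inj₂ refl  = ≤-refl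

count-truncate : (P? : Decidable P) → ∀ {v w} → v ≤ w →
  (∀ i → v ≤ i → i < w → ¬ P i) → count P? w ≡ count P? v
count-truncate P? {v} {zero}  z≤n ¬P = refl
count-truncate P? {v} {suc w} v≤1+w ¬P with m≤n⇒m<n∨m≡n v≤1+w
... | inj₂ refl  = refl
... | inj₁ v<1+w = cong₂ _+_ (indicator-no (P? w) (¬P w (s≤s⁻¹ v<1+w) ≤-refl))
                             (count-truncate P? (s≤s⁻¹ v<1+w)
                                λ i v≤i i<w → ¬P i v≤i (m<n⇒m<1+n i<w))

count-¬ : (P? : Decidable P) (Q? : Decidable Q) → (∀ i → Q i ⇔ (¬ P i)) →
  ∀ v → count P? v + count Q? v ≡ v
count-¬ P? Q? Q⇔¬P zero    = refl
count-¬ P? Q? Q⇔¬P (suc v) = begin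
  (indicator (P? v) + count P? v) + (indicator (Q? v) + count Q? v)
    ≡⟨ interchange (indicator (P? v)) _ _ _ ⟩
  (indicator (P? v) + indicator (Q? v)) + (count P? v + count Q? v)
    ≡⟨ cong₂ _+_ (trans (cong (indicator (P? v) +_)
                           (indicator-cong (Q? v) (¬? (P? v)) (Q⇔¬P v)))
                        (indicator-¬ (P? v)))
                 (count-¬ P? Q? Q⇔¬P v) ⟩
  suc v ∎
  where
  open ≡-Reasoning
  open import Algebra.Properties.CommutativeSemigroup +-commutativeSemigroup
    using (interchange)

count-suc : (P? : Decidable P) → ∀ v →
  count P? (suc v) ≡ indicator (P? 0) + count (P? ∘ suc) v
count-suc P? zero    = refl
count-suc P? (suc v) = begin
  indicator (P? (suc v)) + count P? (suc v)
    ≡⟨ cong (indicator (P? (suc v)) +_) (count-suc P? v) ⟩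
  indicator (P? (suc v)) + (indicator (P? 0) + count (P? ∘ suc) v)
    ≡⟨ x∙yz≈y∙xz (indicator (P? (suc v))) (indicator (P? 0)) _ ⟩
  indicator (P? 0) + count (P? ∘ suc) (suc v) ∎
  where
  open ≡-Reasoning
  open import Algebra.Properties.CommutativeSemigroup +-commutativeSemigroup
    using (x∙yz≈y∙xz)

count-≥ : ∀ m v → count (m ≤?_) v ≡ v ∸ m
count-≥ m zero    = sym (0∸n≡0 m)
count-≥ m (suc v) with m ≤? v
... | yes m≤v = trans (cong suc (count-≥ m v)) (sym (+-∸-assoc 1 m≤v))
... | no  m≰v = trans (count-≥ m v)
  (trans (m≤n⇒m∸n≡0 (<⇒≤ (≰⇒> m≰v))) (sym (m≤n⇒m∸n≡0 (≰⇒> m≰v))))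

length-filter-∷ : {P : Pred A 0ℓ} (P? : Decidable P) → ∀ x xs →
  length (filter P? (x ∷ xs)) ≡ indicator (P? x) + length (filter P? xs)
length-filter-∷ P? x xs with P? x
... | yes _ = refl
... | no  _ = refl

-- Moves counting in lists indexed by `Fin n` to `count`, so that later counts range over natural
-- numbers.
length-filter-tabulate : {P : Pred A 0ℓ} (P? : Decidable P) (Q? : Decidable Q)
  (f : Fin n → A) → (∀ i → P (f i) ⇔ Q (toℕ i)) →
  length (filter P? (tabulate f)) ≡ count Q? n
length-filter-tabulate {n = zero}  P? Q? f P⇔Q = refl
length-filter-tabulate {n = suc n} P? Q? f P⇔Q = begin
  length (filter P? (tabulate f))
    ≡⟨ length-filter-∷ P? (f Fin.zero) _ ⟩
  indicator (P? (f Fin.zero)) + length (filter P? (tabulate (f ∘ Fin.suc)))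
    ≡⟨ cong₂ _+_ (indicator-cong (P? _) (Q? 0) (P⇔Q Fin.zero))
                 (length-filter-tabulate P? (Q? ∘ suc) (f ∘ Fin.suc) (P⇔Q ∘ Fin.suc)) ⟩
  indicator (Q? 0) + count (Q? ∘ suc) n
    ≡⟨ count-suc Q? n ⟨
  count Q? (suc n) ∎
  where open ≡-Reasoning

-- Made for `column`, which is the image of a partial function: an index without a ball must fail
-- `Q`.
length-filter-mapMaybe : {P : Pred B 0ℓ} (P? : Decidable P)
  {Q : Pred A 0ℓ} (Q? : Decidable Q) (f : A → Maybe B) →
  (∀ x → Q x ⇔ ∃ λ y → f x ≡ just y × P y) →
  ∀ xs → length (filter P? (mapMaybe f xs)) ≡ length (filter Q? xs)
length-filter-mapMaybe P? Q? f Q⇔P []       = refl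
length-filter-mapMaybe P? Q? f Q⇔P (x ∷ xs) with f x | Q⇔P x
... | nothing | Qx⇔ = begin
  length (filter P? (mapMaybe f xs))
    ≡⟨ length-filter-mapMaybe P? Q? f Q⇔P xs ⟩
  length (filter Q? xs)
    ≡⟨ cong (_+ length (filter Q? xs))
         (indicator-no (Q? x) λ q → case-nothing (to Qx⇔ q)) ⟨
  indicator (Q? x) + length (filter Q? xs)
    ≡⟨ length-filter-∷ Q? x xs ⟨
  length (filter Q? (x ∷ xs)) ∎
  where
  open ≡-Reasoning
  case-nothing : ∀ {P : Pred B 0ℓ} → ¬ ∃ λ y → nothing ≡ just y × P y
  case-nothing (_ , () , _)
... | just y | Qx⇔ = begin
  length (filter P? (y ∷ mapMaybe f xs))
    ≡⟨ length-filter-∷ P? y _ ⟩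
  indicator (P? y) + length (filter P? (mapMaybe f xs))
    ≡⟨ cong₂ _+_ (indicator-cong (P? y) (Q? x) (mk⇔
         (λ p → from Qx⇔ (y , refl , p))
         (λ q → case-just (to Qx⇔ q))))
         (length-filter-mapMaybe P? Q? f Q⇔P xs) ⟩
  indicator (Q? x) + length (filter Q? xs)
    ≡⟨ length-filter-∷ Q? x xs ⟨
  length (filter Q? (x ∷ xs)) ∎
  where
  open ≡-Reasoning
  case-just : ∀ {P : Pred B 0ℓ} {y} → (∃ λ z → just y ≡ just z × P z) → P y
  case-just (_ , refl , p) = p

-- Bounded search

-- The junk value is n when no number below n satisfies P.
least : Decidable P → ℕ → ℕ
least P? zero    = 0
least P? (suc n) with P? 0
... | yes _ = 0
... | no  _ = suc (least (P? ∘ suc) n)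

least-≤ : (P? : Decidable P) → ∀ n → least P? n ≤ n
least-≤ P? zero    = z≤n
least-≤ P? (suc n) with P? 0
... | yes _ = z≤n
... | no  _ = s≤s (least-≤ (P? ∘ suc) n)

least-satisfies : (P? : Decidable P) → ∀ n → least P? n < n → P (least P? n)
least-satisfies P? (suc n) l<n with P? 0
... | yes p = p
... | no  _ = least-satisfies (P? ∘ suc) n (s<s⁻¹ l<n)

least-minimal : (P? : Decidable P) → ∀ n {j} → P j → least P? n ≤ j
least-minimal P? zero    p = z≤n
least-minimal P? (suc n) {j} p with P? 0 | j
... | yes _  | _     = z≤n
... | no  ¬p | zero  = contradiction p ¬p
... | no  _  | suc j = s≤s (least-minimal (P? ∘ suc) n p)

-- The bound `m ≤ n` takes care of the default value `n` of a failed search.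
least-glb : (P? : Decidable P) → ∀ {m n} → m ≤ n →
  (∀ {j} → j < n → P j → m ≤ j) → m ≤ least P? n
least-glb P? {m} {n} m≤n m≤ with m≤n⇒m<n∨m≡n (least-≤ P? n)
... | inj₁ l<n = m≤ l<n (least-satisfies P? n l<n)
... | inj₂ l≡n = subst (m ≤_) (sym l≡n) m≤n

-- Bracketings

-- Total functions on `ℕ` avoid arithmetic in `Fin n`. The field `i≤c` stops at `n` because `c≤n`
-- caps every value.
record IsBracketing (n : ℕ) (c : ℕ → ℕ) : Set where
  field
    c≤n    : ∀ i → c i ≤ n
    i≤c    : ∀ {i} → i ≤ n → i ≤ c i
    nested : ∀ {i a} → i ≤ a → a ≤ c i → c a ≤ c i

closed : ℕ → (ℕ → ℕ) → ℕ → ℕ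
closed n c v = count (λ i → c i <? v) n

-- This is `u v`, the height at `v`: the nesting depth there, without the bracket opened at `v`
-- itself.
unclosed : (ℕ → ℕ) → ℕ → ℕ
unclosed c v = count (λ i → v ≤? c i) v

closed-cong : ∀ c d → (∀ {i} → i < n → c i ≡ d i) → ∀ v → closed n c v ≡ closed n d v
closed-cong {n} c d c≗d v = count-cong (λ i → c i <? v) (λ i → d i <? v) n λ i i<n →
  mk⇔ (subst (_< v) (c≗d i<n)) (subst (_< v) (sym (c≗d i<n)))

module _ {c : ℕ → ℕ} (bracketing : IsBracketing n c) where
  open IsBracketing bracketing

  -- A bracket opened at `i ≥ v` has `c i ≥ i ≥ v`, so only `i < v` contribute to `closed`, and
  -- there the two conditions are complementary.
  closed+unclosed≡ : ∀ {v} → v ≤ n → closed n c v + unclosed c v ≡ v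
  closed+unclosed≡ {v} v≤n = begin
    closed n c v + unclosed c v
      ≡⟨ cong (_+ unclosed c v) (count-truncate (λ i → c i <? v) v≤n
           λ i v≤i i<n ci<v → <⇒≱ ci<v (≤-trans v≤i (i≤c (<⇒≤ i<n)))) ⟩
    count (λ i → c i <? v) v + unclosed c v
      ≡⟨ count-¬ (λ i → c i <? v) (λ i → v ≤? c i) (λ _ → mk⇔ ≤⇒≯ ≮⇒≥) v ⟩
    v ∎
    where open ≡-Reasoning

  closed≤ : ∀ {v} → v ≤ n → closed n c v ≤ v
  closed≤ v≤n = m+n≤o⇒m≤o _ (≤-reflexive (closed+unclosed≡ v≤n))

  -- By nesting, brackets opened from `i` to `c i` close by `c i`. Those open just after `c i` were
  -- therefore opened before `i` and are already open at `i`.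
  unclosed-after-closing : ∀ {i} → i < n → unclosed c (suc (c i)) ≤ unclosed c i
  unclosed-after-closing {i} i<n = begin
    count (λ j → suc (c i) ≤? c j) (suc (c i))
      ≡⟨ count-truncate (λ j → suc (c i) ≤? c j) (m≤n⇒m≤1+n (i≤c (<⇒≤ i<n)))
           (λ j i≤j j<1+ci → ≤⇒≯ (nested i≤j (s≤s⁻¹ j<1+ci))) ⟩
    count (λ j → suc (c i) ≤? c j) i
      ≤⟨ count-mono (λ j → suc (c i) ≤? c j) (λ j → i ≤? c j) i
           (λ _ _ ci<cj → ≤-trans (i≤c (<⇒≤ i<n)) (<⇒≤ ci<cj)) ⟩
    count (λ j → i ≤? c j) i ∎
    where open ≤-Reasoning

  -- By nesting, every bracket counted at `i` encloses the one opened at `i`, so it is still open at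
  -- `v`; the bracket of `i` itself is one more.
  unclosed-before-closing : ∀ {i v} → i < v → v ≤ c i → unclosed c i < unclosed c v
  unclosed-before-closing {i} {v} i<v v≤ci = begin
    suc (count (λ j → i ≤? c j) i)
      ≤⟨ s≤s (count-mono (λ j → i ≤? c j) (λ j → v ≤? c j) i
           λ _ j<i i≤cj → ≤-trans v≤ci (nested (<⇒≤ j<i) i≤cj)) ⟩
    suc (count (λ j → v ≤? c j) i)
      ≡⟨ cong (_+ count (λ j → v ≤? c j) i) (indicator-yes (v ≤? c i) v≤ci) ⟨
    count (λ j → v ≤? c j) (suc i)
      ≤⟨ count-monoʳ (λ j → v ≤? c j) i<v ⟩
    count (λ j → v ≤? c j) v ∎
    where open ≤-Reasoning

-- If `c i < d i`, then at `c i + 1` the height of `c` is back to at most its value at `i`, while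
-- that of `d` is strictly above. Equal heights exclude this.
closed-reflects-≤ : ∀ {c d} → IsBracketing n c → IsBracketing n d →
  (∀ {v} → v ≤ n → closed n c v ≡ closed n d v) → ∀ {i} → i < n → d i ≤ c i
closed-reflects-≤ {n} {c} {d} bc bd same {i} i<n = ≮⇒≥ λ ci<di →
  <⇒≱ (unclosed-before-closing bd (s≤s (IsBracketing.i≤c bc (<⇒≤ i<n))) ci<di)
      (subst₂ _≤_ (same-unclosed (≤-trans ci<di (IsBracketing.c≤n bd i)))
                  (same-unclosed (<⇒≤ i<n))
                  (unclosed-after-closing bc i<n))
  where
  same-unclosed : ∀ {v} → v ≤ n → unclosed c v ≡ unclosed d v
  same-unclosed {v} v≤n = +-cancelˡ-≡ (closed n c v) _ _ (begin
    closed n c v + unclosed c v ≡⟨ closed+unclosed≡ bc v≤n ⟩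
    v                           ≡⟨ closed+unclosed≡ bd v≤n ⟨
    closed n d v + unclosed d v ≡⟨ cong (_+ unclosed d v) (same v≤n) ⟨
    closed n c v + unclosed d v ∎)
    where open ≡-Reasoning

closed-injective : ∀ {c d} → IsBracketing n c → IsBracketing n d →
  (∀ {v} → v ≤ n → closed n c v ≡ closed n d v) → ∀ {i} → i < n → c i ≡ d i
closed-injective bc bd same i<n = ≤-antisym
  (closed-reflects-≤ bd bc (sym ∘ same) i<n) (closed-reflects-≤ bc bd same i<n)

-- Bracketings with prescribed heights

module FromHeights (n : ℕ) (H : ℕ → ℕ) (H≤ : ∀ v → H v ≤ v)
  (H-suc : ∀ v → H (suc v) ≤ suc (H v)) where

  -- The bracket of `i` is to close at the first such `v`, where the step to `v + 1` brings the
  -- height back to `H i` or lower. If there is none below `n`, it closes at `n`.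
  Closes : ℕ → ℕ → Set
  Closes i v = i ≤ v × H (suc v) ≤ H i

  closes? : ∀ i → Decidable (Closes i)
  closes? i v = i ≤? v ×-dec H (suc v) ≤? H i

  close : ℕ → ℕ
  close i = least (closes? i) n

  i≤close : ∀ {i} → i ≤ n → i ≤ close i
  i≤close {i} i≤n = least-glb (closes? i) i≤n λ _ → proj₁

  -- While the bracket of `i` is open, the height stays above `H i`. Hence `H i < H a`, and the drop
  -- that closes `i` also closes `a`.
  close-nested : ∀ {i a} → i ≤ a → a ≤ close i → close a ≤ close i
  close-nested {i} {a} i≤a a≤ci
    with m≤n⇒m<n∨m≡n (least-≤ (closes? i) n) | m≤n⇒m<n∨m≡n i≤a
  ... | inj₂ ci≡n | _         = subst (close a ≤_) (sym ci≡n) (least-≤ (closes? a) n)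
  ... | _         | inj₂ refl = ≤-refl
  ... | inj₁ ci<n | inj₁ (s≤s {n = u} i≤u) = least-minimal (closes? a) n
    (a≤ci , ≤-trans (proj₂ (least-satisfies (closes? i) n ci<n)) (<⇒≤ Hi<Ha))
    where
    Hi<Ha : H i < H a
    Hi<Ha = ≰⇒> λ Ha≤Hi → <⇒≱ a≤ci (least-minimal (closes? i) n (i≤u , Ha≤Hi))

  isBracketing : IsBracketing n close
  isBracketing = record
    { c≤n    = λ i → least-≤ (closes? i) n
    ; i≤c    = i≤close
    ; nested = close-nested
    }

  Pending : ℕ → ℕ → Pred ℕ 0ℓ
  Pending h v i = H i < h × v ≤ close i

  pending? : ∀ h v → Decidable (Pending h v)
  pending? h v i = H i <? h ×-dec v ≤? close i

  -- An open bracket survives `v` iff `H i < H (v + 1)`, so passing `v` only lowers the threshold.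
  -- Since `v < n`, closing at `v` is a real drop and not the default.
  pending-suc : ∀ {h v i} → i ≤ v → v < n →
    Pending h (suc v) i ⇔ Pending (h ⊓ H (suc v)) v i
  pending-suc {h} {v} {i} i≤v v<n = mk⇔
    (λ (Hi<h , v<ci) → ⊓-glb Hi<h (≰⇒> λ H≤Hi →
       <⇒≱ v<ci (least-minimal (closes? i) n (i≤v , H≤Hi))) , <⇒≤ v<ci)
    (λ (Hi<m , v≤ci) → m<n⊓o⇒m<n h _ Hi<m , ≤∧≢⇒< v≤ci λ v≡ci →
       <⇒≱ (m<n⊓o⇒m<o h _ Hi<m)
           (subst (λ u → H (suc u) ≤ H i) (sym v≡ci)
             (proj₂ (least-satisfies (closes? i) n (subst (_< n) v≡ci v<n)))))

  -- The threshold h makes the induction on v go through: a step to v + 1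
  -- closes exactly the pending brackets of height at least H (v + 1).
  count-pending : ∀ h v → v ≤ n → count (pending? h v) v ≡ h ⊓ H v
  count-pending h zero    _   = sym (trans (cong (h ⊓_) (n≤0⇒n≡0 (H≤ 0))) (⊓-zeroʳ h))
  count-pending h (suc v) v<n = begin
    count (pending? h (suc v)) (suc v)
      ≡⟨ count-cong (pending? h (suc v)) (pending? m v) (suc v)
           (λ i i≤v → pending-suc (s≤s⁻¹ i≤v) v<n) ⟩
    indicator (pending? m v v) + count (pending? m v) v
      ≡⟨ cong (indicator (pending? m v v) +_) (count-pending m v (<⇒≤ v<n)) ⟩
    indicator (pending? m v v) + m ⊓ H v
      ≡⟨ opening ⟩
    m ∎
    where
    open ≡-Reasoning
    m = h ⊓ H (suc v)
    opening : indicator (pending? m v v) + m ⊓ H v ≡ m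
    -- The bracket opened at `v` is pending iff `H v < m`. In that case `m` is `H v + 1`, since
    -- heights rise by at most one.
    opening with <-≤-connex (H v) m
    ... | inj₁ Hv<m = begin
      indicator (pending? m v v) + m ⊓ H v
        ≡⟨ cong₂ _+_ (indicator-yes (pending? m v v) (Hv<m , i≤close (<⇒≤ v<n)))
                     (m≥n⇒m⊓n≡n (<⇒≤ Hv<m)) ⟩
      suc (H v)
        ≡⟨ ≤-antisym Hv<m (≤-trans (m⊓n≤n h (H (suc v))) (H-suc v)) ⟩
      m ∎
    ... | inj₂ m≤Hv = cong₂ _+_ (indicator-no (pending? m v v) (≤⇒≯ m≤Hv ∘ proj₁))
                              (m≤n⇒m⊓n≡m m≤Hv)

  unclosed≡H : ∀ {v} → v ≤ n → unclosed close v ≡ H v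
  unclosed≡H {v} v≤n = begin
    count (λ i → v ≤? close i) v
      -- The threshold `v` excludes nothing, because `H i ≤ i < v`.
      ≡⟨ count-cong (λ i → v ≤? close i) (pending? v v) v
           (λ i i<v → mk⇔ (≤-<-trans (H≤ i) i<v ,_) proj₂) ⟩
    count (pending? v v) v
      ≡⟨ count-pending v v v≤n ⟩
    v ⊓ H v
      ≡⟨ m≥n⇒m⊓n≡n (H≤ v) ⟩
    H v ∎
    where open ≡-Reasoning

-- The heights to realise are `v ∸ p v`; they rise by at most one per step because `p` is monotone
-- and `p v ≤ v`.
closed-surjective : (p : ℕ → ℕ) → (∀ v → p v ≤ v) → (∀ v → p v ≤ p (suc v)) →
  ∀ n → ∃ λ c → IsBracketing n c × (∀ {v} → v ≤ n → closed n c v ≡ p v)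
closed-surjective p p≤ p-suc n = close , isBracketing , closed≡p
  where
  open FromHeights n (λ v → v ∸ p v) (λ v → m∸n≤m v (p v))
    (λ v → ≤-trans (∸-monoʳ-≤ (suc v) (p-suc v)) (≤-reflexive (+-∸-assoc 1 (p≤ v))))

  closed≡p : ∀ {v} → v ≤ n → closed n close v ≡ p v
  closed≡p {v} v≤n = +-cancelʳ-≡ (v ∸ p v) _ _ (begin
    closed n close v + (v ∸ p v)      ≡⟨ cong (closed n close v +_) (unclosed≡H v≤n) ⟨
    closed n close v + unclosed close v ≡⟨ closed+unclosed≡ isBracketing v≤n ⟩
    v                                 ≡⟨ m+[n∸m]≡n (p≤ v) ⟨
    p v + (v ∸ p v)                   ∎)
    where open ≡-Reasoning

-- Torsion classes

-- Membership by numerical coordinates. It is false outside the triangle, so it carries the bounds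
-- `i ≤ j` and `j < n`.
Contains : BallSet n → ℕ → ℕ → Set
Contains S i j = ∃ λ X → X ∈ S × toℕ (left X) ≡ i × toℕ (right X) ≡ j

contains? : (S : BallSet n) → ∀ i j → Dec (Contains S i j)
contains? S i j = any-ball? λ X →
  member? S X ×-dec (toℕ (left X) ≟ i ×-dec toℕ (right X) ≟ j)

ball-≡ : {X Z : Ball n} → toℕ (left X) ≡ toℕ (left Z) →
  toℕ (right X) ≡ toℕ (right Z) → X ≡ Z
ball-≡ {X = [ i , j ]⟨ _ ⟩} {[ i′ , j′ ]⟨ _ ⟩} i≡ j≡
  with refl ← Fin.toℕ-injective i≡ | refl ← Fin.toℕ-injective j≡ = refl

∈⇒contains : (S : BallSet n) → ∀ {X} → X ∈ S → Contains S (toℕ (left X)) (toℕ (right X))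
∈⇒contains S X∈S = _ , X∈S , refl , refl

contains⇒∈ : (S : BallSet n) → ∀ X → Contains S (toℕ (left X)) (toℕ (right X)) → X ∈ S
contains⇒∈ S X (Z , Z∈S , l , r) = subst (Member S) (ball-≡ l r) Z∈S

contains⇒≤ : (S : BallSet n) → ∀ {i j} → Contains S i j → i ≤ j
contains⇒≤ S ([ i , j ]⟨ i≤j ⟩ , _ , refl , refl) = recompute (i Fin.≤? j) i≤j

contains⇒<n : (S : BallSet n) → ∀ {i j} → Contains S i j → j < n
contains⇒<n S (X , _ , _ , refl) = Fin.toℕ<n (right X)

ball : ∀ {i j} → i ≤ j → j < n → ∃ λ (X : Ball n) → toℕ (left X) ≡ i × toℕ (right X) ≡ j
ball i≤j j<n =
  [ fromℕ< (≤-<-trans i≤j j<n) , fromℕ< j<n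
    ]⟨ subst₂ _≤_ (sym (Fin.toℕ-fromℕ< (≤-<-trans i≤j j<n))) (sym (Fin.toℕ-fromℕ< j<n)) i≤j ⟩
  , Fin.toℕ-fromℕ< (≤-<-trans i≤j j<n) , Fin.toℕ-fromℕ< j<n

-- The value n encodes an empty column.
lowest : BallSet n → ℕ → ℕ
lowest {n} S i = least (contains? S i) n

lowest-contained : (S : BallSet n) → ∀ {i} → lowest S i < n → Contains S i (lowest S i)
lowest-contained {n} S {i} = least-satisfies (contains? S i) n

lowest≤ : (S : BallSet n) → ∀ {i j} → Contains S i j → lowest S i ≤ j
lowest≤ {n} S {i} = least-minimal (contains? S i) n

lowest-antitone : (S T : BallSet n) → (∀ {i j} → Contains S i j → Contains T i j) →
  ∀ i → lowest T i ≤ lowest S i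
lowest-antitone {n} S T S⊆T i =
  least-glb (contains? S i) (least-≤ (contains? T i) n) λ _ s → lowest≤ T (S⊆T s)

contains-mono : (S T : BallSet n) → (∀ {X} → X ∈ S → X ∈ T) →
  ∀ {i j} → Contains S i j → Contains T i j
contains-mono S T S⊆T (X , X∈S , l , r) = X , S⊆T X∈S , l , r

lowest-cong : {G G′ : TorsionClass n} → G ≈ₜ G′ →
  ∀ i → lowest (ballSet G) i ≡ lowest (ballSet G′) i
lowest-cong {G = G} {G′} (G⊆G′ , G′⊆G) i = ≤-antisym
  (lowest-antitone (ballSet G′) (ballSet G) (contains-mono (ballSet G′) (ballSet G) G′⊆G) i)
  (lowest-antitone (ballSet G) (ballSet G′) (contains-mono (ballSet G) (ballSet G′) G⊆G′) i)

-- Closure properties of torsion classes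

module _ (G : TorsionClass n) where
  private
    S = ballSet G
    module Pair = IsTorsionPair (proj₂ (isTorsionPair G))

  -- A nonzero map from the quotient `[ a , j ]` to some `V` in `F` would give one from `[ i , j ]`
  -- to `V`.
  quotient-closed : ∀ {i a j} → Contains S i j → i ≤ a → a ≤ j → Contains S a j
  quotient-closed (X , X∈S , refl , refl) i≤a a≤j
    with Z , refl , r ← ball a≤j (Fin.toℕ<n (right X)) =
    Z , proj₂ Pair.G≐⊥F (λ V V∈F (l≤ , ≤r , r≤) →
      proj₁ Pair.G≐⊥F X∈S V V∈F
        (≤-trans i≤a l≤ , subst (toℕ (left V) ≤_) r ≤r , subst (_≤ toℕ (right V)) r r≤))
    , refl , r

  -- A nonzero map from `[ i , j ]` to `V` gives one from `[ i , k ]` if `left V ≤ k`, and one from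
  -- `[ k + 1 , j ]` otherwise.
  extension-closed : ∀ {i k j} → Contains S i k → Contains S (suc k) j → Contains S i j
  extension-closed {i} {k} {j} ik@(X , X∈S , refl , refl) kj@(X′ , X′∈S , l′ , refl)
    with Z , l , r ← ball (≤-trans (contains⇒≤ S ik) (<⇒≤ (contains⇒≤ S kj)))
                          (contains⇒<n S kj) =
    Z , proj₂ Pair.G≐⊥F no-hom , l , r
    where
    no-hom : ∀ V → V ∈ proj₁ (isTorsionPair G) → ¬ Hom≠0 Z V
    no-hom V V∈F (l≤ , ≤r , r≤) with ≤-<-connex (toℕ (left V)) k
    ... | inj₁ a≤k = proj₁ Pair.G≐⊥F X∈S V V∈F
      (subst (_≤ toℕ (left V)) l l≤ , a≤k ,
       ≤-trans (<⇒≤ (contains⇒≤ S kj)) (subst (_≤ toℕ (right V)) r r≤))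
    ... | inj₂ k<a = proj₁ Pair.G≐⊥F X′∈S V V∈F
      (subst (_≤ toℕ (left V)) (sym l′) k<a , subst (toℕ (left V) ≤_) r ≤r ,
       subst (_≤ toℕ (right V)) r r≤)

  lowest-isBracketing : IsBracketing n (lowest S)
  lowest-isBracketing = record
    { c≤n    = c≤n
    ; i≤c    = λ {i} i≤n → least-glb (contains? S i) i≤n λ _ → contains⇒≤ S
    ; nested = nested
    }
    where
    c≤n : ∀ i → lowest S i ≤ n
    c≤n i = least-≤ (contains? S i) n

    nested : ∀ {i a} → i ≤ a → a ≤ lowest S i → lowest S a ≤ lowest S i
    nested {i} {a} i≤a a≤c with m≤n⇒m<n∨m≡n (c≤n i)
    ... | inj₁ c<n = lowest≤ S (quotient-closed (lowest-contained S c<n) i≤a a≤c)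
    ... | inj₂ c≡n = subst (lowest S a ≤_) (sym c≡n) (c≤n a)

-- Induction on the bound `k` for the length of the ball. If `c < j`, the shorter quotient
-- `[ c + 1 , j ]` passes to `G′` by induction and is glued to `[ i , c ]`.
contains-determined : (G G′ : TorsionClass n) →
  (∀ {i} → i < n → lowest (ballSet G) i ≡ lowest (ballSet G′) i) →
  ∀ k {i j} → j < i + k → Contains (ballSet G) i j → Contains (ballSet G′) i j
contains-determined G G′ same zero {i} j<i ij =
  contradiction (subst (_ <_) (+-identityʳ i) j<i) (≤⇒≯ (contains⇒≤ (ballSet G) ij))
contains-determined {n} G G′ same (suc k) {i} {j} j<i+1+k ij =
  extend (m≤n⇒m<n∨m≡n c≤j)
  where
  c = lowest (ballSet G) i

  c≤j : c ≤ j
  c≤j = lowest≤ (ballSet G) ij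

  j<n : j < n
  j<n = contains⇒<n (ballSet G) ij

  i≤c : i ≤ c
  i≤c = contains⇒≤ (ballSet G) (lowest-contained (ballSet G) (≤-<-trans c≤j j<n))

  c≡c′ : c ≡ lowest (ballSet G′) i
  c≡c′ = same (≤-<-trans (≤-trans i≤c c≤j) j<n)

  ic : Contains (ballSet G′) i c
  ic = subst (Contains (ballSet G′) i) (sym c≡c′)
    (lowest-contained (ballSet G′) (subst (_< n) c≡c′ (≤-<-trans c≤j j<n)))

  extend : c < j ⊎ c ≡ j → Contains (ballSet G′) i j
  extend (inj₂ c≡j) = subst (Contains (ballSet G′) i) c≡j ic
  extend (inj₁ c<j) = extension-closed G′ ic
    (contains-determined G G′ same k
      (<-≤-trans j<i+1+k (≤-trans (≤-reflexive (+-suc i k)) (s≤s (+-monoˡ-≤ k i≤c))))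
      (quotient-closed G ij (m≤n⇒m≤1+n i≤c) c<j))

-- The torsion class of a bracketing

closes-within : ∀ {c} → IsBracketing n c → ∀ (X : Ball n) {i} →
  toℕ (left X) ≡ i → toℕ (right X) ≡ c i →
  ∀ (a : Fin n) → left X Fin.≤ a → a Fin.≤ right X → c (toℕ a) ≤ toℕ (right X)
closes-within {c = c} bracketing X refl r a l≤a a≤r = subst (c (toℕ a) ≤_) (sym r)
  (IsBracketing.nested bracketing l≤a (subst (toℕ a ≤_) r a≤r))

-- `F` takes the balls strictly below height `c` in their column, and `G` the balls none of whose
-- quotients `[ a , j ]` lies in `F`.
fromBracketing : ∀ {c} → IsBracketing n c → TorsionClass n
fromBracketing {n} {c} bracketing = record
  { ballSet       = G
  ; isTorsionPair = F , record
    { G≐⊥F = (λ {X} X∈G Y Y∈F → orthogonal X Y X∈G Y∈F) , λ {X} → G-complete X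
    ; F≐G⊥ = (λ {Y} Y∈F X X∈G → orthogonal X Y X∈G Y∈F) , λ {Y} → F-complete Y
    }
  }
  where
  open IsBracketing bracketing

  G F : BallSet n
  G = record
    { Member  = λ X → ∀ a → left X Fin.≤ a → a Fin.≤ right X → c (toℕ a) ≤ toℕ (right X)
    ; member? = λ X → Fin.all? λ a → (left X Fin.≤? a) →-dec
                        ((a Fin.≤? right X) →-dec (c (toℕ a) ≤? toℕ (right X)))
    }
  F = record
    { Member  = λ Y → toℕ (right Y) < c (toℕ (left Y))
    ; member? = λ Y → toℕ (right Y) <? c (toℕ (left Y))
    }

  orthogonal : ∀ X Y → X ∈ G → Y ∈ F → ¬ Hom≠0 X Y
  orthogonal X Y X∈G Y∈F (l≤ , ≤r , r≤) =
    <⇒≱ Y∈F (≤-trans (X∈G (left Y) l≤ ≤r) r≤)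

  G-complete : ∀ X → (∀ Y → Y ∈ F → ¬ Hom≠0 X Y) → X ∈ G
  -- A violating `a` makes the quotient `[ a , right X ]` of `X` a member of `F`.
  G-complete X X⊥F a l≤a a≤r = ≮⇒≥ λ r<ca →
    X⊥F [ a , right X ]⟨ a≤r ⟩ r<ca (l≤a , a≤r , ≤-refl)

  F-complete : ∀ Y → (∀ X → X ∈ G → ¬ Hom≠0 X Y) → Y ∈ F
  -- With `a` the left end of `Y`, the ball `[ a , c a ]` is in `G` and maps to `Y` once
  -- `c a ≤ right Y`.
  F-complete Y G⊥Y = ≰⇒> λ c≤r →
    let a = toℕ (left Y)
        X , l , r = ball (i≤c (<⇒≤ (Fin.toℕ<n (left Y)))) (≤-<-trans c≤r (Fin.toℕ<n (right Y)))
    in G⊥Y X (closes-within bracketing X l r)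
         (≤-reflexive l ,
          subst (a ≤_) (sym r) (i≤c (<⇒≤ (Fin.toℕ<n (left Y)))) ,
          subst (_≤ toℕ (right Y)) (sym r) c≤r)

lowest-fromBracketing : ∀ {c} (bracketing : IsBracketing n c) →
  ∀ {i} → i < n → lowest (ballSet (fromBracketing bracketing)) i ≡ c i
lowest-fromBracketing {n} {c} bracketing {i} i<n = ≤-antisym lowest≤c c≤lowest
  where
  open IsBracketing bracketing
  G = ballSet (fromBracketing bracketing)

  c≤lowest : c i ≤ lowest G i
  c≤lowest = least-glb (contains? G i) (c≤n i)
    λ { _ ij@(X , X∈G , refl , refl) → X∈G (left X) ≤-refl (contains⇒≤ G ij) }

  lowest≤c : lowest G i ≤ c i
  lowest≤c with m≤n⇒m<n∨m≡n (c≤n i)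
  ... | inj₂ c≡n = subst (lowest G i ≤_) (sym c≡n) (least-≤ (contains? G i) n)
  ... | inj₁ c<n with X , l , r ← ball (i≤c (<⇒≤ i<n)) c<n =
    lowest≤ G (X , closes-within bracketing X l r , l , r)

-- Young diagrams

module _ (G : TorsionClass n) where
  private
    c = lowest (ballSet G)

  box⇔lowest≤ : ∀ X → X ∈ Y G ⇔ c (toℕ (left X)) ≤ toℕ (right X)
  box⇔lowest≤ X = mk⇔
    (λ { (L , (L∈G , _) , refl , L≤X) →
         ≤-trans (lowest≤ (ballSet G) (∈⇒contains (ballSet G) L∈G)) L≤X })
    -- Since `right X < n`, the value of `lowest` is not the default, so the column has a lowest
    -- ball.
    (λ c≤r → boxed c≤r (lowest-contained (ballSet G) (≤-<-trans c≤r (Fin.toℕ<n (right X)))))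
    where
    boxed : c (toℕ (left X)) ≤ toℕ (right X) →
      Contains (ballSet G) (toℕ (left X)) (c (toℕ (left X))) → X ∈ Y G
    boxed c≤r (L , L∈G , l , r) =
      L , (L∈G , minimal) , Fin.toℕ-injective l , subst (_≤ toℕ (right X)) (sym r) c≤r
      where
      minimal : ∀ Z → left Z ≡ left L → Z ∈ ballSet G → right L Fin.≤ right Z
      minimal Z refl Z∈G = subst (_≤ toℕ (right Z)) (sym r)
        (lowest≤ (ballSet G) (Z , Z∈G , l , refl))

  columnLength≡ : ∀ i → columnLength (Y G) i ≡ n ∸ c (toℕ i)
  columnLength≡ i = begin
    columnLength (Y G) i
      ≡⟨ length-filter-mapMaybe (member? (Y G)) (λ j → c (toℕ i) ≤? toℕ j) _
           (λ j → in-column j (i Fin.≤? j)) (allFin n) ⟩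
    length (filter (λ j → c (toℕ i) ≤? toℕ j) (allFin n))
      ≡⟨ length-filter-tabulate {n = n} (λ j → c (toℕ i) ≤? toℕ j) (c (toℕ i) ≤?_) (λ j → j)
           (λ _ → mk⇔ (λ c≤j → c≤j) (λ c≤j → c≤j)) ⟩
    count (c (toℕ i) ≤?_) n
      ≡⟨ count-≥ (c (toℕ i)) n ⟩
    n ∸ c (toℕ i) ∎
    where
    open ≡-Reasoning
    open IsBracketing (lowest-isBracketing G) using (i≤c)
    in-column : ∀ j (i≤?j : Dec (i Fin.≤ j)) → c (toℕ i) ≤ toℕ j ⇔
      ∃ λ X → Maybe.map (λ i≤j → [ i , j ]⟨ i≤j ⟩) (dec⇒maybe i≤?j) ≡ just X × X ∈ Y G
    in-column j (yes i≤j) = mk⇔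
      (λ c≤j → _ , refl , from (box⇔lowest≤ [ i , j ]⟨ i≤j ⟩) c≤j)
      (λ { (X , refl , X∈Y) → to (box⇔lowest≤ X) X∈Y })
    -- There is no ball here, and `i ≤ c i` makes the numerical condition fail as well.
    in-column j (no i≰j) = mk⇔
      (λ c≤j → contradiction (≤-trans (i≤c (<⇒≤ (Fin.toℕ<n i))) c≤j) i≰j)
      (λ { (_ , () , _) })

  -- Sorting only permutes the column lengths `n ∸ c i`, and `k < n ∸ c i` is equivalent to
  -- `c i < n ∸ k`.
  row-removeGaps : ∀ k → row (removeGaps (Y G)) k ≡ closed n c (n ∸ k)
  row-removeGaps k = begin
    length (filter (k <?_) (SortDecreasing.sort lengths))
      ≡⟨ ↭-length (filter-↭ (k <?_) (SortDecreasing.sort-↭ lengths)) ⟩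
    length (filter (k <?_) lengths)
      ≡⟨ cong (length ∘ filter (k <?_)) (map-tabulate (λ i → i) (columnLength (Y G))) ⟩
    length (filter (k <?_) (tabulate (columnLength (Y G))))
      ≡⟨ length-filter-tabulate (k <?_) (λ i → c i <? n ∸ k) (columnLength (Y G))
           (λ i → subst (λ l → k < l ⇔ c (toℕ i) < n ∸ k) (sym (columnLength≡ i))
             (mk⇔ (<∸-swap (c (toℕ i))) (<∸-swap k))) ⟩
    closed n c (n ∸ k) ∎
    where
    open ≡-Reasoning
    lengths = map (columnLength (Y G)) (allFin n)
    <∸-swap : ∀ m {l} → l < n ∸ m → m < n ∸ l
    <∸-swap m {l} l<n∸m = ≰⇒> λ n∸l≤m → <⇒≱ l<n∸m (m≤n+o⇒m∸n≤o n m
      (≤-trans (m≤n+m∸n n l)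
        (≤-trans (+-monoʳ-≤ l n∸l≤m) (≤-reflexive (+-comm l m)))))

  removeGaps-isSubdiagram : IsSubdiagram n (removeGaps (Y G))
  removeGaps-isSubdiagram = record
    { row≤  = λ k _ → row≤n∸k k
    ; row≡0 = λ k k≥n → n≤0⇒n≡0 (subst (row (removeGaps (Y G)) k ≤_) (m≤n⇒m∸n≡0 k≥n) (row≤n∸k k))
    }
    where
    row≤n∸k : ∀ k → row (removeGaps (Y G)) k ≤ n ∸ k
    row≤n∸k k = subst (_≤ n ∸ k) (sym (row-removeGaps k))
      (closed≤ (lowest-isBracketing G) (m∸n≤m n k))

-- The bijection

removeGaps-cong : {G G′ : TorsionClass n} → G ≈ₜ G′ → removeGaps (Y G) ≈ᵧ removeGaps (Y G′)
removeGaps-cong {n} {G} {G′} G≈G′ k = begin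
  row (removeGaps (Y G)) k                ≡⟨ row-removeGaps G k ⟩
  closed n (lowest (ballSet G)) (n ∸ k)
    ≡⟨ closed-cong {n} _ _ (λ {i} _ → lowest-cong {G = G} {G′} G≈G′ i) (n ∸ k) ⟩
  closed n (lowest (ballSet G′)) (n ∸ k)  ≡⟨ row-removeGaps G′ k ⟨
  row (removeGaps (Y G′)) k               ∎
  where open ≡-Reasoning

removeGaps-injective : {G G′ : TorsionClass n} → removeGaps (Y G) ≈ᵧ removeGaps (Y G′) → G ≈ₜ G′
removeGaps-injective {n} {G} {G′} same =
  contained G G′ same-lowest , contained G′ G (sym ∘ same-lowest)
  where
  same-closed : ∀ {v} → v ≤ n →
    closed n (lowest (ballSet G)) v ≡ closed n (lowest (ballSet G′)) v
  -- Every `v ≤ n` has the form `n ∸ k` with `k = n ∸ v`, so the rows give all values of `closed`.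
  same-closed {v} v≤n = subst
    (λ u → closed n (lowest (ballSet G)) u ≡ closed n (lowest (ballSet G′)) u)
    (m∸[m∸n]≡n v≤n)
    (trans (sym (row-removeGaps G (n ∸ v))) (trans (same (n ∸ v)) (row-removeGaps G′ (n ∸ v))))

  same-lowest : ∀ {i} → i < n → lowest (ballSet G) i ≡ lowest (ballSet G′) i
  same-lowest = closed-injective (lowest-isBracketing G) (lowest-isBracketing G′) same-closed

  contained : (G G′ : TorsionClass n) →
    (∀ {i} → i < n → lowest (ballSet G) i ≡ lowest (ballSet G′) i) →
    ∀ {X} → X ∈ ballSet G → X ∈ ballSet G′
  -- The bound `n` on the length suffices, since `right X < n`.
  contained G G′ same {X} X∈G = contains⇒∈ (ballSet G′) X
    (contains-determined G G′ same n (m≤n⇒m≤o+n _ (Fin.toℕ<n (right X)))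
      (∈⇒contains (ballSet G) X∈G))

row-antitone : (D : YoungDiagram) → ∀ {k l} → k ≤ l → row D l ≤ row D k
row-antitone D {k} {zero}  z≤n = ≤-refl
row-antitone D {k} {suc l} k≤1+l with m≤n⇒m<n∨m≡n k≤1+l
... | inj₁ k<1+l = ≤-trans (decreasing D l) (row-antitone D (s≤s⁻¹ k<1+l))
... | inj₂ refl  = ≤-refl

removeGaps-surjective : (D : YoungDiagram) → IsSubdiagram n D →
  ∃ λ (G : TorsionClass n) → removeGaps (Y G) ≈ᵧ D
removeGaps-surjective {n} D D⊆ =
  let c , bracketing , closed≡p = closed-surjective p p≤ p-suc n
      G = fromBracketing bracketing
  in G , λ k → begin
    row (removeGaps (Y G)) k                ≡⟨ row-removeGaps G k ⟩
    closed n (lowest (ballSet G)) (n ∸ k)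
      ≡⟨ closed-cong {n} _ c (lowest-fromBracketing bracketing) (n ∸ k) ⟩
    closed n c (n ∸ k)                      ≡⟨ closed≡p (m∸n≤m n k) ⟩
    p (n ∸ k)                               ≡⟨ p-n∸ k ⟩
    row D k                                 ∎
  where
  open ≡-Reasoning
  open IsSubdiagram D⊆

  -- The rows read from the bottom up: the staircase bound becomes `p v ≤ v`, and decreasing rows
  -- make `p` monotone.
  p : ℕ → ℕ
  p v = row D (n ∸ v)

  row≤n∸k : ∀ k → row D k ≤ n ∸ k
  row≤n∸k k with <-≤-connex k n
  ... | inj₁ k<n = row≤ k k<n
  ... | inj₂ n≤k = subst (_≤ n ∸ k) (sym (row≡0 k n≤k)) z≤n

  p≤ : ∀ v → p v ≤ v
  p≤ v = ≤-trans (row≤n∸k (n ∸ v)) (m≤n+o⇒m∸n≤o n (n ∸ v)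
    (≤-trans (m≤n+m∸n n v) (≤-reflexive (+-comm v (n ∸ v)))))

  p-suc : ∀ v → p v ≤ p (suc v)
  p-suc v = row-antitone D (∸-monoʳ-≤ n (n≤1+n v))

  p-n∸ : ∀ k → p (n ∸ k) ≡ row D k
  p-n∸ k with <-≤-connex k n
  ... | inj₁ k<n = cong (row D) (m∸[m∸n]≡n (<⇒≤ k<n))
  -- Beyond the triangle `n ∸ k` truncates to `0`, which yields row `n`; this row and row `k` are
  -- both empty.
  ... | inj₂ n≤k = begin
    row D (n ∸ (n ∸ k)) ≡⟨ cong (λ m → row D (n ∸ m)) (m≤n⇒m∸n≡0 n≤k) ⟩
    row D n             ≡⟨ row≡0 n ≤-refl ⟩
    0                   ≡⟨ row≡0 k n≤k ⟨
    row D k             ∎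

mainTheorem7 : (n : ℕ) → n ≥ 1 →
    Σ[ sub ∈ ((G : TorsionClass n) → IsSubdiagram n (removeGaps (Y G))) ]
    IsBijection (_≈ₜ_ {n}) (_≈ₛ_ {n}) (λ G → removeGaps (Y G) , sub G)
mainTheorem7 n _ = removeGaps-isSubdiagram , record
  { isInjection = record
    { isCongruent = record
      { cong           = λ {G} {G′} → removeGaps-cong {G = G} {G′}
      ; isEquivalence₁ = On.isEquivalence (Member ∘ ballSet) ≐-isEquivalence
      ; isEquivalence₂ = On.isEquivalence (row ∘ proj₁) record
        { refl  = λ _ → refl
        ; sym   = λ D≈E k → sym (D≈E k)
        ; trans = λ D≈E E≈F k → trans (D≈E k) (E≈F k)
        }
      }
    ; injective   = λ {G} {G′} → removeGaps-injective {G = G} {G′}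
    }
  ; surjective  = λ (D , D⊆) →
      let G , G↦D = removeGaps-surjective D D⊆
      in G , λ {G′} G′≈G k → trans (removeGaps-cong {G = G′} {G} G′≈G k) (G↦D k)
  }
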